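{- For all positive integers $n\geq 2$ and $t$, the double Roman domination number of $S(K_n,t)$ is $$\gamma_{dR}(S(K_n,t))=\begin{cases}3\left\lceil\frac{n^t}{n+1}\right\rceil & \text{if } t \text{ is odd},\\[2pt] 3\left\lceil\frac{n^t}{n+1}\right\rceil-1 & \text{if } t \text{ is even}.\end{cases}$$
   Context: For a positive integer $n$ let $[n]=\{1,\dots,n\}$. For positive integers $n,t$, the Sierpiński graph $S(K_n,t)$ is the simple graph with vertex set $[n]^t$ (words $v_1v_2\cdots v_t$ with $v_i\in[n]$), in which $u_1\cdots u_t$ and $v_1\cdots v_t$ are adjacent if and only if there is $s\in[t]$ with $u_j=v_j$ for all $j<s$, $u_s\neq v_s$, and $u_j=v_s$ and $v_j=u_s$ for all $j>s$. A double Roman dominating function on a graph $G=(V,E)$ is a function $f:V\to\{0,1,2,3\}$ such that (i) every vertex $u$ with $f(u)=0$ has either a neighbor $v$ with $f(v)=3$ or two distinct neighbors $w,x$ with $f(w)=f(x)=2$, and (ii) every vertex $u$ with $f(u)=1$ has a neighbor $v$ with $f(v)\geq 3$. Its weight is $\sum_{v\in V}f(v)$, and the double Roman domination number $\gamma_{dR}(G)$ is the minimum weight of a double Roman dominating function on $G$. -}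

module Defs where

open import Data.Fin.Base as Fin using (Fin; toℕ)
open import Data.Integer.Base using (+_; ∣_∣)
open import Data.List.Base using (List; []; _∷_; map; allFin; cartesianProductWith)
open import Data.List.Membership.Propositional using (_∈_)
open import Data.List.Membership.Propositional.Properties using (∈-allFin; ∈-cartesianProductWith⁺)
open import Data.List.Relation.Unary.All as All using ()
open import Data.List.Relation.Unary.AllPairs as AllPairs using ()
open import Data.List.Relation.Unary.Any using (here)
open import Data.List.Relation.Unary.Unique.Propositional using (Unique)
open import Data.List.Relation.Unary.Unique.Propositional.Properties
  using (allFin⁺; cartesianProductWith⁺)
open import Data.Nat.Base using (ℕ; zero; suc; NonZero; _≤_; _≥_)
open import Data.Nat.ListAction using (sum)
open import Data.Product.Base using (_×_; _,_; ∃-syntax; proj₁; proj₂)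
open import Data.Rational.Unnormalised.Base using (_/_; ceiling)
open import Data.Sum.Base using (_⊎_)
open import Data.Vec.Base as Vec using (Vec; lookup)
open import Data.Vec.Properties using (∷-injective)
open import Relation.Binary.Definitions using (Symmetric)
open import Relation.Binary.PropositionalEquality using (_≡_; _≢_; refl; sym)
open import Relation.Nullary.Negation.Core using (¬_)

-- Finiteness is witnessed by a list containing every vertex exactly once, so
-- that sums over the vertex set are sums along that list.
record FiniteSimpleGraph : Set₁ where
  field
    Vertex    : Set
    Adj       : Vertex → Vertex → Set
    adj-sym   : Symmetric Adj
    adj-irrefl : ∀ v → ¬ Adj v v
    vertices  : List Vertex
    vertices-unique   : Unique vertices
    vertices-complete : ∀ v → v ∈ vertices

module _ (G : FiniteSimpleGraph) where
  open FiniteSimpleGraph G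

  record IsDoubleRomanDominating (f : Vertex → Fin 4) : Set where
    field
      dominates₀ : ∀ u → toℕ (f u) ≡ 0 →
        (∃[ v ] Adj u v × toℕ (f v) ≡ 3) ⊎
        (∃[ w ] ∃[ x ] w ≢ x × Adj u w × Adj u x × toℕ (f w) ≡ 2 × toℕ (f x) ≡ 2)
      dominates₁ : ∀ u → toℕ (f u) ≡ 1 → ∃[ v ] Adj u v × toℕ (f v) ≥ 3

  weight : (Vertex → Fin 4) → ℕ
  weight f = sum (map (λ v → toℕ (f v)) vertices)

  -- γdR k says γ_dR(G) = k, i.e. k is the minimum weight; such a k is unique.
  record γdR (k : ℕ) : Set where
    field
      attained : ∃[ f ] IsDoubleRomanDominating f × weight f ≡ k
      minimal  : ∀ f → IsDoubleRomanDominating f → k ≤ weight f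

module _ (n : ℕ) where

  words : ∀ t → List (Vec (Fin n) t)
  words zero    = Vec.[] ∷ []
  words (suc t) = cartesianProductWith Vec._∷_ (allFin n) (words t)

  words-unique : ∀ t → Unique (words t)
  words-unique zero    = All.[] AllPairs.∷ AllPairs.[]
  words-unique (suc t) =
    cartesianProductWith⁺ Vec._∷_ ∷-injective (allFin⁺ n) (words-unique t)

  words-complete : ∀ {t} (v : Vec (Fin n) t) → v ∈ words t
  words-complete Vec.[]      = here refl
  words-complete (i Vec.∷ v) =
    ∈-cartesianProductWith⁺ Vec._∷_ (∈-allFin i) (words-complete v)

record SierpińskiAdj {n t : ℕ} (u v : Vec (Fin n) t) : Set where
  field
    s      : Fin t
    before : ∀ j → j Fin.< s → lookup u j ≡ lookup v j
    at     : lookup u s ≢ lookup v s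
    after  : ∀ j → s Fin.< j → lookup u j ≡ lookup v s × lookup v j ≡ lookup u s

-- S(K_n, t)
Sierpiński : ℕ → ℕ → FiniteSimpleGraph
Sierpiński n t = record
  { Vertex            = Vec (Fin n) t
  ; Adj               = SierpińskiAdj
  ; adj-sym           = λ a → let open SierpińskiAdj a in record
      { s      = s
      ; before = λ j j<s → sym (before j j<s)
      ; at     = λ eq → at (sym eq)
      ; after  = λ j s<j → proj₂ (after j s<j) , proj₁ (after j s<j)
      }
  ; adj-irrefl        = λ v a → SierpińskiAdj.at a refl
  ; vertices          = words n t
  ; vertices-unique   = words-unique n t
  ; vertices-complete = words-complete n
  }

-- ⌈ a / d ⌉ as a natural number; the ceiling is nonnegative, so ∣_∣ only
-- changes its type from ℤ to ℕ.
⌈_÷_⌉ : (a d : ℕ) .{{_ : NonZero d}} → ℕ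
⌈ a ÷ d ⌉ = ∣ ceiling (+ a / d) ∣

{-# OPTIONS --safe #-}

-- Lower bound, by discharging: a vertex of value 3 sends 2 to itself and to each neighbour, a vertex
-- of value 2 sends 2 to itself and 1 to each neighbour, where an extreme vertex iᵗ (of degree n - 1)
-- counts as its own nth neighbour.  Domination implies that every vertex receives at least 2, so a
-- threes and b twos satisfy 2 nᵗ + excess = b + (n + 1)(b + 2a) with excess ≥ 0.  If every vertex
-- receives exactly 2, then connectivity rules out twos; hence excess = 0 implies b = 0, and together
-- with divisibility this excludes 3a + 2b below the claimed value.
--
-- Upper bound: a finite automaton reading words from the left accepts a code that dominates every
-- vertex exactly once, except that for even t it misses one extreme vertex.  The codewords get 3,
-- and the missed vertex gets 2.
module Submission where

open import Defs
open import Data.Bool.Base using (Bool; true; false; not; if_then_else_)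
open import Data.Bool.Properties using (not-involutive; not-injective)
open import Data.Fin.Base using (Fin; zero; suc; toℕ)
open import Data.Fin.Properties using (_≟_)
open import Data.List.Base using (List; []; _∷_; _++_; map; length; allFin; cartesianProductWith)
open import Data.List.Membership.Propositional using (_∈_)
open import Data.List.Membership.Propositional.Properties using (∈-allFin; ∈-map⁺)
open import Data.List.Membership.Propositional.Properties.WithK using (unique∧set⇒bag)
open import Data.List.Properties using (map-cong; map-∘; map-++; length-tabulate)
open import Data.List.Relation.Binary.BagAndSetEquality using (∼bag⇒↭)
open import Data.List.Relation.Binary.Permutation.Propositional.Properties using (map⁺)
open import Data.List.Relation.Unary.All as All using ()
open import Data.List.Relation.Unary.AllPairs using (_∷_)
open import Data.List.Relation.Unary.Any using (here; there)
open import Data.List.Relation.Unary.Unique.Propositional using (Unique)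
import Data.List.Relation.Unary.Unique.Propositional.Properties as Unique
open import Data.Maybe.Base using (Maybe; just; nothing; is-nothing)
open import Data.Nat.Base
  using (ℕ; zero; suc; _+_; _*_; _∸_; _^_; _≤_; _<_; parity; z≤n; s≤s; z<s; s<s; s≤s⁻¹; s<s⁻¹)
open import Data.Nat.DivMod
  using (_/_; _%_; [m+kn]%n≡m%n; m*n%n≡0; m%n<n; m<n⇒m%n≡m; m<n⇒m/n≡0; m*n/n≡m; +-distrib-/)
open import Data.Nat.ListAction using (sum)
open import Data.Nat.ListAction.Properties using (sum-++; sum-↭)
open import Data.Nat.Properties
  using (suc-injective; +-comm; +-identityʳ; +-mono-≤; +-monoʳ-≤; +-cancelˡ-≡; +-cancelʳ-≡;
         *-comm; *-assoc; *-zeroʳ; *-identityʳ; *-suc; *-distribˡ-+; *-cancelˡ-<; m+1+n≢m;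
         ≤-refl; ≤-trans; ≤-antisym; ≤-reflexive; m≤m+n; m≤n+m; m+[n∸m]≡n; m∸n≡0⇒m≤n; ≮⇒≥;
         m+n≡0⇒m≡0; n≤0⇒n≡0; m≤n⇒∃[o]m+o≡n; module ≤-Reasoning)
open import Data.Nat.Tactic.RingSolver using (solve-∀)
open import Data.Parity.Base using (0ℙ; 1ℙ)
open import Data.Product.Base using (_×_; _,_; ∃-syntax; proj₁; proj₂)
open import Data.Sum.Base using (_⊎_; inj₁; inj₂)
open import Data.Vec.Base using (Vec; []; _∷_; replicate; lookup; last)
open import Data.Vec.Properties using (≡-dec; lookup-replicate; ∷-injectiveˡ)
open import Function.Base using (_∘_)
open import Function.Bundles using (mk⇔)
open import Relation.Binary.Definitions using (DecidableEquality)
open import Relation.Binary.PropositionalEquality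
  using (_≡_; _≢_; refl; sym; trans; cong; cong₂; subst; module ≡-Reasoning)
open import Relation.Nullary.Decidable using (Dec; yes; no; does; map′; dec-true; dec-false)
open import Relation.Nullary.Negation.Core using (¬_; contradiction)

private variable
  A B C : Set
  n m : ℕ

-- Finite sums

∑ : List A → (A → ℕ) → ℕ
∑ xs f = sum (map f xs)

∑-cong : ∀ {f g : A → ℕ} xs → (∀ x → f x ≡ g x) → ∑ xs f ≡ ∑ xs g
∑-cong xs f≗g = cong sum (map-cong f≗g xs)

∑-mono : ∀ {f g : A → ℕ} xs → (∀ x → f x ≤ g x) → ∑ xs f ≤ ∑ xs g
∑-mono []       f≤g = z≤n
∑-mono (x ∷ xs) f≤g = +-mono-≤ (f≤g x) (∑-mono xs f≤g)

+-interchange : ∀ a b c d → (a + b) + (c + d) ≡ (a + c) + (b + d)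
+-interchange = solve-∀

∑-+ : ∀ (f g : A → ℕ) xs → ∑ xs (λ x → f x + g x) ≡ ∑ xs f + ∑ xs g
∑-+ f g []       = refl
∑-+ f g (x ∷ xs) =
  trans (cong (f x + g x +_) (∑-+ f g xs)) (+-interchange (f x) (g x) (∑ xs f) (∑ xs g))

∑-* : ∀ k (f : A → ℕ) xs → ∑ xs (λ x → k * f x) ≡ k * ∑ xs f
∑-* k f []       = sym (*-zeroʳ k)
∑-* k f (x ∷ xs) =
  trans (cong (k * f x +_) (∑-* k f xs)) (sym (*-distribˡ-+ k (f x) (∑ xs f)))

∑-const : ∀ k (xs : List A) → ∑ xs (λ _ → k) ≡ length xs * k
∑-const k []       = refl
∑-const k (x ∷ xs) = cong (k +_) (∑-const k xs)

∑-allFin-const : ∀ n k → ∑ (allFin n) (λ _ → k) ≡ n * k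
∑-allFin-const n k =
  trans (∑-const k (allFin n)) (cong (_* k) (length-tabulate {n = n} (λ i → i)))

∑-swap : ∀ (h : A → B → ℕ) xs ys →
  ∑ xs (λ x → ∑ ys (h x)) ≡ ∑ ys (λ y → ∑ xs (λ x → h x y))
∑-swap h []       ys = sym (trans (∑-const 0 ys) (*-zeroʳ (length ys)))
∑-swap h (x ∷ xs) ys =
  trans (cong (∑ ys (h x) +_) (∑-swap h xs ys)) (sym (∑-+ (h x) _ ys))

∑-cartesianProductWith : ∀ (f : C → ℕ) (_⊗_ : A → B → C) xs ys →
  ∑ (cartesianProductWith _⊗_ xs ys) f ≡ ∑ xs (λ x → ∑ ys (λ y → f (x ⊗ y)))
∑-cartesianProductWith f _⊗_ []       ys = refl
∑-cartesianProductWith f _⊗_ (x ∷ xs) ys = begin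
  sum (map f (map (x ⊗_) ys ++ rest))
    ≡⟨ cong sum (map-++ f (map (x ⊗_) ys) rest) ⟩
  sum (map f (map (x ⊗_) ys) ++ map f rest)
    ≡⟨ sum-++ (map f (map (x ⊗_) ys)) (map f rest) ⟩
  sum (map f (map (x ⊗_) ys)) + ∑ rest f
    ≡⟨ cong₂ _+_ (cong sum (sym (map-∘ ys))) (∑-cartesianProductWith f _⊗_ xs ys) ⟩
  ∑ ys (λ y → f (x ⊗ y)) + ∑ xs (λ x → ∑ ys (λ y → f (x ⊗ y))) ∎
  where
  open ≡-Reasoning
  rest = cartesianProductWith _⊗_ xs ys

∈⇒≤∑ : ∀ (f : A → ℕ) {x xs} → x ∈ xs → f x ≤ ∑ xs f
∈⇒≤∑ f (here refl)              = m≤m+n _ _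
∈⇒≤∑ f {xs = y ∷ _} (there x∈) = ≤-trans (∈⇒≤∑ f x∈) (m≤n+m _ (f y))

∈⇒+≤∑ : ∀ (f : A → ℕ) {x y xs} → x ≢ y → x ∈ xs → y ∈ xs → f x + f y ≤ ∑ xs f
∈⇒+≤∑ f x≢y (here refl) (here refl) = contradiction refl x≢y
∈⇒+≤∑ f x≢y (here refl) (there y∈)  = +-monoʳ-≤ _ (∈⇒≤∑ f y∈)
∈⇒+≤∑ f {x} {y} x≢y (there x∈) (here refl) =
  ≤-trans (≤-reflexive (+-comm (f x) (f y))) (+-monoʳ-≤ (f y) (∈⇒≤∑ f x∈))
∈⇒+≤∑ f {xs = z ∷ _} x≢y (there x∈) (there y∈) =
  ≤-trans (∈⇒+≤∑ f x≢y x∈ y∈) (m≤n+m _ (f z))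

∑>0⇒∃ : ∀ (f : A → ℕ) xs → 0 < ∑ xs f → ∃[ x ] 0 < f x
∑>0⇒∃ f (x ∷ xs) ∑>0 with f x in eq
... | suc _ = x , subst (0 <_) (sym eq) z<s
... | zero  = ∑>0⇒∃ f xs ∑>0

𝟙 : {P : Set} → Dec P → ℕ
𝟙 P? = if does P? then 1 else 0

∑-𝟙 : ∀ (_≟′_ : DecidableEquality A) {x xs} → Unique xs → x ∈ xs →
  ∑ xs (λ y → 𝟙 (x ≟′ y)) ≡ 1
∑-𝟙 {A = A} _≟′_ {x} (x∉ ∷ _) (here refl) = cong₂ _+_ at-x (off-x x∉)
  where
  at-x : 𝟙 (x ≟′ x) ≡ 1
  at-x rewrite dec-true (x ≟′ x) refl = refl
  off-x : ∀ {ys} → All.All (x ≢_) ys → ∑ ys (λ y → 𝟙 (x ≟′ y)) ≡ 0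
  off-x All.[] = refl
  off-x {y ∷ _} (x≢y All.∷ p) rewrite dec-false (x ≟′ y) x≢y = off-x p
∑-𝟙 _≟′_ {x} {y ∷ _} (y∉ ∷ u) (there x∈)
  rewrite dec-false (x ≟′ y) (All.lookup y∉ x∈ ∘ sym) = ∑-𝟙 _≟′_ u x∈

∑-involution : ∀ (π : A → A) {xs} → (∀ x → π (π x) ≡ x) → Unique xs → (∀ x → x ∈ xs) →
  ∀ f → ∑ xs (f ∘ π) ≡ ∑ xs f
∑-involution π {xs} π² u complete f = trans (cong sum (map-∘ xs)) (sum-↭ (map⁺ f
  (∼bag⇒↭ (unique∧set⇒bag (Unique.map⁺ π-injective u) u
    (λ {x} → mk⇔ (λ _ → complete x)
                 (λ _ → subst (_∈ map π xs) (π² x) (∈-map⁺ π (complete (π x)))))))))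
  where
  π-injective : ∀ {x y} → π x ≡ π y → x ≡ y
  π-injective {x} {y} eq = trans (sym (π² x)) (trans (cong π eq) (π² y))

-- Neighbours in the Sierpiński graph

infixl 6 _[last]≔_

-- Over all `k`, the words `v [last]≔ k` form the copy of the complete graph that contains `v`.
_[last]≔_ : Vec A (suc m) → A → Vec A (suc m)
(_ ∷ [])        [last]≔ k = k ∷ []
(i ∷ v@(_ ∷ _)) [last]≔ k = i ∷ (v [last]≔ k)

[last]≔-last : (v : Vec A (suc m)) → v [last]≔ last v ≡ v
[last]≔-last (_ ∷ [])        = refl
[last]≔-last (i ∷ v@(_ ∷ _)) = cong (i ∷_) ([last]≔-last v)

[last]≔-idem : ∀ (v : Vec A (suc m)) k l → (v [last]≔ k) [last]≔ l ≡ v [last]≔ l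
[last]≔-idem (_ ∷ [])            k l = refl
[last]≔-idem (i ∷ _ ∷ [])        k l = refl
[last]≔-idem (i ∷ v@(_ ∷ _ ∷ _)) k l = cong (i ∷_) ([last]≔-idem v k l)

IsConst : Vec A m → Set
IsConst v = ∃[ k ] v ≡ replicate _ k

isConst? : (v : Vec (Fin n) (suc m)) → Dec (IsConst v)
isConst? v@(k ∷ _) =
  map′ (k ,_) (λ { (_ , refl) → refl }) (≡-dec _≟_ v (replicate _ k))

-- The neighbour outside the clique { v [last]≔ k }, except that extreme vertices are fixed points.
partner : Vec (Fin n) (suc m) → Vec (Fin n) (suc m)
partner (i ∷ [])        = i ∷ []
partner (i ∷ v@(_ ∷ _)) with isConst? v
... | yes (k , _) = k ∷ replicate _ i
... | no  _       = i ∷ partner v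

partner-link : ∀ (i k : Fin n) → partner (i ∷ replicate (suc m) k) ≡ k ∷ replicate (suc m) i
partner-link {m = m} i k with isConst? (replicate (suc m) k)
... | yes (l , eq) = cong (_∷ replicate _ i) (sym (∷-injectiveˡ eq))
... | no  ¬const   = contradiction (k , refl) ¬const

partner-inner : ∀ (i : Fin n) {v : Vec (Fin n) (suc m)} → ¬ IsConst v →
  partner (i ∷ v) ≡ i ∷ partner v
partner-inner i {v@(_ ∷ _)} ¬const with isConst? v
... | yes const = contradiction const ¬const
... | no  _     = refl

partner-replicate : ∀ m (k : Fin n) → partner (replicate (suc m) k) ≡ replicate (suc m) k
partner-replicate zero    k = refl
partner-replicate (suc m) k = partner-link k k

partner-involutive : (v : Vec (Fin n) (suc m)) → partner (partner v) ≡ v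
partner-involutive (i ∷ []) = refl
partner-involutive (i ∷ v@(_ ∷ _)) with isConst? v
... | yes (k , eq) = trans (partner-link k i) (cong (i ∷_) (sym eq))
... | no  ¬const   = trans (partner-inner i ¬const′) (cong (i ∷_) (partner-involutive v))
  where
  -- Constant words are fixed by `partner`, so a constant partner would make `v` itself constant.
  ¬const′ : ¬ IsConst (partner v)
  ¬const′ (k , eq) = ¬const (k , (begin
    v                        ≡⟨ partner-involutive v ⟨
    partner (partner v)      ≡⟨ cong partner eq ⟩
    partner (replicate _ k)  ≡⟨ partner-replicate _ k ⟩
    replicate _ k            ∎))
    where open ≡-Reasoning

adj-∷ : ∀ (i : Fin n) {u v : Vec (Fin n) m} → SierpińskiAdj u v → SierpińskiAdj (i ∷ u) (i ∷ v)
adj-∷ i a = record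
  { s      = suc s
  ; before = λ { zero _ → refl ; (suc j) j<s → before j (s<s⁻¹ j<s) }
  ; at     = at
  ; after  = λ { (suc j) s<j → after j (s<s⁻¹ s<j) }
  }
  where open SierpińskiAdj a

adj-link : ∀ {i j : Fin n} → i ≢ j → SierpińskiAdj (i ∷ replicate m j) (j ∷ replicate m i)
adj-link {i = i} {j} i≢j = record
  { s      = zero
  ; before = λ _ ()
  ; at     = i≢j
  ; after  = λ { (suc l) _ → lookup-replicate l j , lookup-replicate l i }
  }

adj-[last]≔ : ∀ (v : Vec (Fin n) (suc m)) k → v [last]≔ k ≢ v → SierpińskiAdj v (v [last]≔ k)
adj-[last]≔ (i ∷ [])        k ≢v = adj-link (λ { refl → ≢v refl })
adj-[last]≔ (i ∷ v@(_ ∷ _)) k ≢v = adj-∷ i (adj-[last]≔ v k (≢v ∘ cong (i ∷_)))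

adj-partner : ∀ (v : Vec (Fin n) (suc m)) → partner v ≢ v → SierpińskiAdj v (partner v)
adj-partner (i ∷ [])        ≢v = contradiction refl ≢v
adj-partner (i ∷ v@(_ ∷ _)) ≢v with isConst? v
... | yes (k , refl) = adj-link (λ { refl → ≢v refl })
... | no  _          = adj-∷ i (adj-partner v (≢v ∘ cong (i ∷_)))

lookup-const : ∀ (v : Vec A m) {k} → (∀ j → lookup v j ≡ k) → v ≡ replicate m k
lookup-const []      eq = refl
lookup-const (i ∷ v) eq = cong₂ _∷_ (eq zero) (lookup-const v (eq ∘ suc))

-- Words that first differ in the last letter share a clique; a difference at an earlier position
-- determines both suffixes, which leaves only the link.
adj⇒clique⊎partner : ∀ {u v : Vec (Fin n) (suc m)} → SierpińskiAdj u v →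
  (∃[ k ] u [last]≔ k ≡ v) ⊎ partner u ≡ v
adj⇒clique⊎partner {u = i ∷ u} {j ∷ v} record { s = zero ; after = after }
  with u | v | lookup-const u (λ l → proj₁ (after (suc l) z<s))
             | lookup-const v (λ l → proj₂ (after (suc l) z<s))
... | []    | []    | _    | _    = inj₁ (j , refl)
... | _ ∷ _ | _ ∷ _ | refl | refl = inj₂ (partner-link i j)
adj⇒clique⊎partner {u = i ∷ u@(_ ∷ _)} {j ∷ v@(_ ∷ _)}
  record { s = suc s ; before = before ; at = at ; after = after }
  with refl ← before zero z<s
  with adj⇒clique⊎partner {u = u} {v} (record
         { s = s ; before = λ l l<s → before (suc l) (s<s l<s) ; at = at
         ; after = λ l s<l → after (suc l) (s<s s<l) })
... | inj₁ (k , eq) = inj₁ (k , cong (i ∷_) eq)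
... | inj₂ eq with isConst? u
...   | no ¬const = inj₂ (cong (i ∷_) eq)
-- A constant inner word is its own inner partner, so the two words would agree at `s`.
...   | yes (k , u≡) = contradiction
          (cong (λ w → lookup w s) (trans u≡ (trans (sym (partner-replicate _ k))
            (trans (cong partner (sym u≡)) eq)))) at

-- Connectivity as an induction principle: inside copy `i` the induction reaches `i` followed by all
-- `k`, the link leads into copy `k`, and the induction there reaches the extreme vertex.
propagate : (P : Vec (Fin n) (suc m) → Set) →
  (∀ v k → P v → P (v [last]≔ k)) → (∀ v → P v → P (partner v)) →
  ∀ v → P v → ∀ k → P (replicate (suc m) k)
propagate P P-last P-partner (i ∷ []) Pv k = P-last (i ∷ []) k Pv
propagate {n} {suc m} P P-last P-partner (i ∷ v@(_ ∷ _)) Pv k = under-head k (bridge (i ≟ k))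
  where
  inner : ∀ j v → P (j ∷ v) → P (j ∷ partner v)
  inner j v p with isConst? v
  -- The inner partner can differ from the outer one only at a constant inner word, where it is the
  -- identity.
  ... | yes (l , refl) = subst (P ∘ (j ∷_)) (sym (partner-replicate m l)) p
  ... | no  ¬const     = subst P (partner-inner j ¬const) (P-partner (j ∷ v) p)
  from : ∀ j v → P (j ∷ v) → ∀ l → P (j ∷ replicate (suc m) l)
  from j = propagate (P ∘ (j ∷_)) (λ { v@(_ ∷ _) l → P-last (j ∷ v) l }) (inner j)
  bridge : Dec (i ≡ k) → ∃[ w ] P (k ∷ w)
  bridge (yes refl) = v , Pv
  bridge (no _)     = _ , subst P (partner-link i k) (P-partner _ (from i v Pv k))
  under-head : ∀ j → ∃[ w ] P (j ∷ w) → P (j ∷ replicate (suc m) j)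
  under-head j (w , p) = from j w p j

-- Double counting of neighbourhoods

clique : (Vec (Fin n) (suc m) → ℕ) → Vec (Fin n) (suc m) → ℕ
clique {n} g u = ∑ (allFin n) (λ k → g (u [last]≔ k))

-- The closed neighbourhood sum, since the clique sum includes `u` itself; an extreme vertex, being
-- its own partner, counts twice.
coverage : (Vec (Fin n) (suc m) → ℕ) → Vec (Fin n) (suc m) → ℕ
coverage g u = clique g u + g (partner u)

clique-[last]≔ : ∀ (g : Vec (Fin n) (suc m) → ℕ) u k → clique g (u [last]≔ k) ≡ clique g u
clique-[last]≔ {n} g u k = ∑-cong (allFin n) (λ l → cong g ([last]≔-idem u k l))

[last]≔≤clique : ∀ (g : Vec (Fin n) (suc m) → ℕ) u k → g (u [last]≔ k) ≤ clique g u
[last]≔≤clique g u k = ∈⇒≤∑ (λ l → g (u [last]≔ l)) (∈-allFin k)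

clique-self : ∀ (g : Vec (Fin n) (suc m) → ℕ) u → g u ≤ clique g u
clique-self g u = subst (λ w → g w ≤ clique g u) ([last]≔-last u)
  ([last]≔≤clique g u (last u))

∑-words : ∀ n m (g : Vec (Fin n) (suc m) → ℕ) →
  ∑ (words n (suc m)) g ≡ ∑ (allFin n) (λ i → ∑ (words n m) (λ v → g (i ∷ v)))
∑-words n m g = ∑-cartesianProductWith g _∷_ (allFin n) (words n m)

∑-words-const : ∀ n m k → ∑ (words n m) (λ _ → k) ≡ n ^ m * k
∑-words-const n zero    k = refl
∑-words-const n (suc m) k = begin
  ∑ (words n (suc m)) (λ _ → k)                   ≡⟨ ∑-words n m _ ⟩
  ∑ (allFin n) (λ _ → ∑ (words n m) (λ _ → k))    ≡⟨ ∑-allFin-const n _ ⟩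
  n * ∑ (words n m) (λ _ → k)                     ≡⟨ cong (n *_) (∑-words-const n m k) ⟩
  n * (n ^ m * k)                                 ≡⟨ *-assoc n (n ^ m) k ⟨
  n ^ suc m * k                                   ∎
  where open ≡-Reasoning

∑-clique : ∀ n m (g : Vec (Fin n) (suc m) → ℕ) →
  ∑ (words n (suc m)) (clique g) ≡ n * ∑ (words n (suc m)) g
∑-clique n zero g = begin
  ∑ (words n 1) (clique g)                           ≡⟨ ∑-words n 0 (clique g) ⟩
  ∑ (allFin n) (λ _ → K + 0)                         ≡⟨ ∑-allFin-const n (K + 0) ⟩
  n * (K + 0)                                        ≡⟨ cong (n *_) (+-identityʳ K) ⟩
  n * K
    ≡⟨ cong (n *_) (∑-cong (allFin n) (λ k → sym (+-identityʳ _))) ⟩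
  n * ∑ (allFin n) (λ i → ∑ (words n 0) (λ v → g (i ∷ v))) ≡⟨ cong (n *_) (∑-words n 0 g) ⟨
  n * ∑ (words n 1) g                                ∎
  where
  open ≡-Reasoning
  K = ∑ (allFin n) (λ k → g (k ∷ []))
∑-clique n (suc m) g = begin
  ∑ (words n (2 + m)) (clique g)
    ≡⟨ ∑-words n (suc m) (clique g) ⟩
  ∑ (allFin n) (λ i → ∑ (words n (suc m)) (λ v → clique g (i ∷ v)))
    ≡⟨ ∑-cong (allFin n) (λ i → ∑-cong (words n (suc m)) (λ { (_ ∷ _) → refl })) ⟩
  ∑ (allFin n) (λ i → ∑ (words n (suc m)) (clique (g ∘ (i ∷_))))
    ≡⟨ ∑-cong (allFin n) (λ i → ∑-clique n m (g ∘ (i ∷_))) ⟩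
  ∑ (allFin n) (λ i → n * ∑ (words n (suc m)) (g ∘ (i ∷_)))
    ≡⟨ ∑-* n _ (allFin n) ⟩
  n * ∑ (allFin n) (λ i → ∑ (words n (suc m)) (g ∘ (i ∷_)))
    ≡⟨ cong (n *_) (∑-words n (suc m) g) ⟨
  n * ∑ (words n (2 + m)) g ∎
  where open ≡-Reasoning

-- A loop at each extreme vertex makes the graph `n`-regular, so each value is counted n + 1 times.
-- This serves charges in the lower bound and codewords in the upper bound.
∑-coverage : ∀ n m (g : Vec (Fin n) (suc m) → ℕ) →
  ∑ (words n (suc m)) (coverage g) ≡ suc n * ∑ (words n (suc m)) g
∑-coverage n m g = begin
  ∑ W (coverage g)                 ≡⟨ ∑-+ (clique g) (g ∘ partner) W ⟩
  ∑ W (clique g) + ∑ W (g ∘ partner)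
    ≡⟨ cong₂ _+_ (∑-clique n m g)
         (∑-involution partner partner-involutive (words-unique n (suc m)) (words-complete n) g) ⟩
  n * ∑ W g + ∑ W g                ≡⟨ +-comm (n * ∑ W g) (∑ W g) ⟩
  suc n * ∑ W g                    ∎
  where
  open ≡-Reasoning
  W = words n (suc m)

-- Lower bound

-- `gain` is the charge sent to each neighbour: 1 from value 2, 2 from value 3.
two three gain : Fin 4 → ℕ
two zero                         = 0
two (suc zero)                   = 0
two (suc (suc zero))             = 1
two (suc (suc (suc zero)))       = 0
three zero                       = 0
three (suc zero)                 = 0
three (suc (suc zero))           = 0
three (suc (suc (suc zero)))     = 1
gain x = two x + 2 * three x

3three+2two≤ : ∀ x → 3 * three x + 2 * two x ≤ toℕ x
3three+2two≤ zero                   = z≤n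
3three+2two≤ (suc zero)             = z≤n
3three+2two≤ (suc (suc zero))       = ≤-refl
3three+2two≤ (suc (suc (suc zero))) = ≤-refl

gain-3 : ∀ x → 3 ≤ toℕ x → gain x ≡ 2
gain-3 (suc (suc (suc zero))) _ = refl
gain-3 (suc zero)       (s≤s ())
gain-3 (suc (suc zero)) (s≤s (s≤s ()))

gain-2 : ∀ x → toℕ x ≡ 2 → gain x ≡ 1
gain-2 (suc (suc zero)) _ = refl

module _ (f : Vec (Fin n) (suc m) → Fin 4) where

  -- The extra `two (f u)` raises from 1 to 2 what a vertex of value 2 sends to itself.
  received : Vec (Fin n) (suc m) → ℕ
  received u = two (f u) + coverage (gain ∘ f) u

  adj⇒gain≤coverage : ∀ {u v} → SierpińskiAdj u v → gain (f v) ≤ coverage (gain ∘ f) u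
  adj⇒gain≤coverage {u} uv with adj⇒clique⊎partner uv
  ... | inj₁ (k , refl) = ≤-trans ([last]≔≤clique (gain ∘ f) u k) (m≤m+n _ _)
  ... | inj₂ refl       = m≤n+m _ (clique (gain ∘ f) u)

  -- Distinctness makes the two gains separate terms of the coverage: different letters in the
  -- clique, or one in the clique and one across the link.
  two-neighbours⇒2≤coverage : ∀ {u v w} → v ≢ w → SierpińskiAdj u v → SierpińskiAdj u w →
    toℕ (f v) ≡ 2 → toℕ (f w) ≡ 2 → 2 ≤ coverage (gain ∘ f) u
  two-neighbours⇒2≤coverage {u} {v} {w} v≢w uv uw fv≡2 fw≡2
    with adj⇒clique⊎partner uv | adj⇒clique⊎partner uw
  ... | inj₁ (k , refl) | inj₁ (l , refl) =
        ≤-trans (subst (_≤ clique (gain ∘ f) u)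
                   (cong₂ _+_ (gain-2 (f v) fv≡2) (gain-2 (f w) fw≡2))
                   (∈⇒+≤∑ (λ k → gain (f (u [last]≔ k))) (v≢w ∘ cong (u [last]≔_)) (∈-allFin k) (∈-allFin l)))
                (m≤m+n _ _)
  ... | inj₁ (k , refl) | inj₂ refl =
        +-mono-≤ (subst (_≤ clique (gain ∘ f) u) (gain-2 (f v) fv≡2)
                    ([last]≔≤clique (gain ∘ f) u k))
                 (≤-reflexive (sym (gain-2 (f w) fw≡2)))
  ... | inj₂ refl | inj₁ (k , refl) =
        +-mono-≤ (subst (_≤ clique (gain ∘ f) u) (gain-2 (f w) fw≡2)
                    ([last]≔≤clique (gain ∘ f) u k))
                 (≤-reflexive (sym (gain-2 (f v) fv≡2)))
  ... | inj₂ refl | inj₂ refl = contradiction refl v≢w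

  2≤received : IsDoubleRomanDominating (Sierpiński n (suc m)) f → ∀ u → 2 ≤ received u
  2≤received dom u = by-value (f u) refl
    where
    open IsDoubleRomanDominating dom
    cov = coverage (gain ∘ f) u
    from-neighbour : ∃[ v ] SierpińskiAdj u v × 3 ≤ toℕ (f v) → 2 ≤ cov
    from-neighbour (v , uv , 3≤fv) = subst (_≤ cov) (gain-3 (f v) 3≤fv) (adj⇒gain≤coverage uv)
    own : gain (f u) ≤ cov
    own = ≤-trans (clique-self (gain ∘ f) u) (m≤m+n _ _)
    by-value : ∀ x → f u ≡ x → 2 ≤ two x + cov
    by-value zero fu with dominates₀ u (cong toℕ fu)
    ... | inj₁ (v , uv , fv≡3) = from-neighbour (v , uv , ≤-reflexive (sym fv≡3))
    ... | inj₂ (v , w , v≢w , uv , uw , fv , fw) = two-neighbours⇒2≤coverage v≢w uv uw fv fw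
    by-value (suc zero) fu = from-neighbour (dominates₁ u (cong toℕ fu))
    by-value (suc (suc zero)) fu = s≤s (subst (λ x → gain x ≤ cov) fu own)
    by-value (suc (suc (suc zero))) fu = subst (λ x → gain x ≤ cov) fu own

  -- If every vertex receives exactly 2, then a single 2 forces every clique to have gain 1:
  -- this property crosses every link, yet it fails at the extreme vertices, which have no link.
  module _ (exact : ∀ u → received u ≡ 2) where

    Unit : Vec (Fin n) (suc m) → Set
    Unit u = clique (gain ∘ f) u ≡ 1

    gain≤1 : ∀ u → Unit u → gain (f u) ≤ 1
    gain≤1 u unit = subst (gain (f u) ≤_) unit (clique-self (gain ∘ f) u)

    received-unit : ∀ u → Unit u → two (f u) + (1 + gain (f (partner u))) ≡ 2
    received-unit u unit =
      trans (cong (λ c → two (f u) + (c + gain (f (partner u)))) (sym unit)) (exact u)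

    -- If `f u` is 0 or 1, the partner must have value 2; if `f u` is 2, the partner must have gain
    -- 0. Either way its own equation leaves clique sum 1.
    Unit-partner : ∀ u → Unit u → Unit (partner u)
    Unit-partner u unit = cross (f u) (f (partner u)) (gain≤1 u unit) (received-unit u unit)
      (trans (cong (λ w → two (f (partner u)) + (clique (gain ∘ f) (partner u) + gain (f w)))
                   (sym (partner-involutive u)))
             (exact (partner u)))
      where
      cross : ∀ x y {c} → gain x ≤ 1 →
        two x + (1 + gain y) ≡ 2 → two y + (c + gain x) ≡ 2 → c ≡ 1
      cross zero       (suc (suc zero)) _ _ eq = trans (sym (+-identityʳ _)) (+-cancelˡ-≡ 1 _ 1 eq)
      cross (suc zero) (suc (suc zero)) _ _ eq = trans (sym (+-identityʳ _)) (+-cancelˡ-≡ 1 _ 1 eq)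
      cross (suc (suc zero)) zero       _ _ eq = +-cancelʳ-≡ 1 _ 1 eq
      cross (suc (suc zero)) (suc zero) _ _ eq = +-cancelʳ-≡ 1 _ 1 eq
      cross (suc (suc (suc zero))) _ (s≤s ()) _ _
      cross zero             (suc (suc (suc zero))) _ () _
      cross (suc zero)       (suc (suc (suc zero))) _ () _
      cross (suc (suc zero)) (suc (suc zero))       _ () _
      cross (suc (suc zero)) (suc (suc (suc zero))) _ () _

    ¬Unit-extreme : ∀ k → ¬ Unit (replicate (suc m) k)
    ¬Unit-extreme k unit = absurd (f z) (gain≤1 z unit)
      (subst (λ w → two (f z) + (1 + gain (f w)) ≡ 2) (partner-replicate m k) (received-unit z unit))
      where
      z = replicate (suc m) k
      -- `two x + gain x` is always 0 or 2, never the required 1.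
      absurd : ∀ x → gain x ≤ 1 → two x + (1 + gain x) ≢ 2
      absurd (suc (suc (suc zero))) (s≤s ()) _

    -- The gain of the vertex itself makes the clique sum at least 1, and the total of 2 leaves no
    -- room for more.
    two⇒Unit : ∀ u → 0 < two (f u) → Unit u
    two⇒Unit u two>0 = squeeze (f u) two>0 (clique-self (gain ∘ f) u) (exact u)
      where
      squeeze : ∀ x {c y} → 0 < two x → gain x ≤ c → two x + (c + y) ≡ 2 → c ≡ 1
      squeeze (suc (suc zero))       {zero}        _ () _
      squeeze (suc (suc zero))       {suc zero}    _ _ _ = refl
      squeeze (suc (suc zero))       {suc (suc _)} _ _ ()
      squeeze (suc (suc (suc zero))) () _ _

    no-two : ∀ u → ¬ 0 < two (f u)
    no-two u two>0 = ¬Unit-extreme (last u)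
      (propagate Unit (λ v k → trans (clique-[last]≔ (gain ∘ f) v k)) Unit-partner
        u (two⇒Unit u two>0) (last u))

-- All that the arithmetic needs of a dominating function of weight `w` on `q` vertices. `balance`
-- counts the total charge by receiver and by sender.
record Discharged (n q w : ℕ) : Set where
  field
    threes twos excess : ℕ
    weight≥  : 3 * threes + 2 * twos ≤ w
    balance  : 2 * q + excess ≡ twos + suc n * (twos + 2 * threes)
    no-twos  : excess ≡ 0 → twos ≡ 0

discharge : ∀ n m (f : Vec (Fin n) (suc m) → Fin 4) →
  IsDoubleRomanDominating (Sierpiński n (suc m)) f →
  Discharged n (n ^ suc m) (weight (Sierpiński n (suc m)) f)
discharge n m f dom = record
  { threes  = ∑ W (three ∘ f)
  ; twos    = ∑ W (two ∘ f)
  ; excess  = ∑ W surplus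
  ; weight≥ = begin
      3 * ∑ W (three ∘ f) + 2 * ∑ W (two ∘ f)
        ≡⟨ cong₂ _+_ (∑-* 3 (three ∘ f) W) (∑-* 2 (two ∘ f) W) ⟨
      ∑ W (λ v → 3 * three (f v)) + ∑ W (λ v → 2 * two (f v))
        ≡⟨ ∑-+ _ _ W ⟨
      ∑ W (λ v → 3 * three (f v) + 2 * two (f v))
        ≤⟨ ∑-mono W (3three+2two≤ ∘ f) ⟩
      ∑ W (toℕ ∘ f) ∎
  ; balance = begin-equality
      2 * n ^ suc m + ∑ W surplus
        ≡⟨ cong (_+ ∑ W surplus) (trans (*-comm 2 (n ^ suc m)) (sym (∑-words-const n (suc m) 2))) ⟩
      ∑ W (λ _ → 2) + ∑ W surplus
        ≡⟨ ∑-+ (λ _ → 2) surplus W ⟨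
      ∑ W (λ v → 2 + surplus v)
        ≡⟨ ∑-cong W (λ v → m+[n∸m]≡n (2≤received f dom v)) ⟩
      ∑ W (received f)
        ≡⟨ ∑-+ (two ∘ f) (coverage (gain ∘ f)) W ⟩
      ∑ W (two ∘ f) + ∑ W (coverage (gain ∘ f))
        ≡⟨ cong (∑ W (two ∘ f) +_) (∑-coverage n m (gain ∘ f)) ⟩
      ∑ W (two ∘ f) + suc n * ∑ W (gain ∘ f)
        ≡⟨ cong (λ s → ∑ W (two ∘ f) + suc n * s)
             (trans (∑-+ (two ∘ f) _ W) (cong (∑ W (two ∘ f) +_) (∑-* 2 (three ∘ f) W))) ⟩
      ∑ W (two ∘ f) + suc n * (∑ W (two ∘ f) + 2 * ∑ W (three ∘ f)) ∎
  ; no-twos = λ excess≡0 → n≤0⇒n≡0 (≮⇒≥ λ twos>0 →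
      let u , two>0 = ∑>0⇒∃ (two ∘ f) W twos>0
      in no-two f (λ v → exact v (subst (surplus v ≤_) excess≡0 (∈⇒≤∑ surplus (words-complete n v)))) u two>0)
  }
  where
  open ≤-Reasoning
  W = words n (suc m)
  surplus : Vec (Fin n) (suc m) → ℕ
  surplus v = received f v ∸ 2
  exact : ∀ v → surplus v ≤ 0 → received f v ≡ 2
  exact v ≤0 = ≤-antisym (m∸n≡0⇒m≤n (n≤0⇒n≡0 ≤0)) (2≤received f dom v)

-- Arithmetic of the weight bounds

m+n≡m⇒n≡0 : ∀ {a b} → a + b ≡ a → b ≡ 0
m+n≡m⇒n≡0 {a} {b} eq = +-cancelˡ-≡ a b 0 (trans eq (sym (+-identityʳ a)))

3*-cancel-≤ : ∀ {a b} e → suc (3 * a + e) ≡ 3 * suc b → a ≤ b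
3*-cancel-≤ {a} {b} e eq = s≤s⁻¹ (*-cancelˡ-< 3 a (suc b)
  (≤-trans (s≤s (m≤m+n (3 * a) e)) (≤-reflexive eq)))

3*-suc : ∀ q → 1 + (3 * q + 2) ≡ 3 * (1 + q)
3*-suc = solve-∀

even-reassoc₀ : ∀ a d → 1 + (3 * a + (1 + d)) ≡ 1 + (1 + (3 * a + 2 * 0) + d)
even-reassoc₀ = solve-∀

even-reassoc₁ : ∀ a d → 1 + (3 * (1 + a) + d) ≡ 1 + (1 + (3 * a + 2 * 1) + d)
even-reassoc₁ = solve-∀

even-slack₀ : ∀ k a e ρ →
  (3 + k) * (2 * a) + (1 + (1 + 2 * (e * (3 + k)) + ρ)) ≡ 2 * (1 + (a + e) * (3 + k)) + ρ
even-slack₀ = solve-∀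

even-slack₁ : ∀ k a e ρ →
  1 + (3 + k) * (1 + 2 * a) + (1 + (3 + k + 2 * (e * (3 + k)) + ρ))
  ≡ 2 * (1 + (1 + a + e) * (3 + k)) + ρ
even-slack₁ = solve-∀

-- Three times the balance plus 2(n + 1) times the weight equation, with n = 2 + k. The nonnegative
-- remainder must vanish; `ρ` stands first in it so that it can be split off.
even-slack₂ : ∀ k q a b ρ d →
  3 * (2 + b + (3 + k) * (2 + b + 2 * a)) + 2 * (3 + k) * (3 * q + 2)
    + (ρ + (2 * ρ + 2 * (3 + k) * d + k * b))
  ≡ 3 * (2 * (1 + q * (3 + k)) + ρ) + 2 * (3 + k) * (1 + (3 * a + 2 * (2 + b)) + d)
even-slack₂ = solve-∀

-- Fewer than two twos supply too little charge. Two twos and q - 1 threes would meet the count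
-- exactly, with weight 3q + 1 and excess 0, so from two twos on `no-twos` decides.
even-bound : ∀ k q {w} → Discharged (2 + k) (1 + q * (3 + k)) w → 3 * q + 2 ≤ w
even-bound k q D = ≤-trans (≮⇒≥ λ lt →
    let d , eq = m≤n⇒∃[o]m+o≡n lt in absurd q threes twos excess d eq balance no-twos) weight≥
  where
  open Discharged D
  absurd : ∀ q a b ρ d → suc (3 * a + 2 * b) + d ≡ 3 * q + 2 →
    2 * (1 + q * (3 + k)) + ρ ≡ b + (3 + k) * (b + 2 * a) → ¬ (ρ ≡ 0 → b ≡ 0)
  absurd q a zero ρ d eq bal _
    with e , refl ← m≤n⇒∃[o]m+o≡n (3*-cancel-≤ {a} {q} (suc d)
                      (trans (even-reassoc₀ a d) (trans (cong suc eq) (3*-suc q)))) =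
    m+1+n≢m _ (trans (even-slack₀ k a e ρ) bal)
  absurd q a 1 ρ d eq bal _
    with e , refl ← m≤n⇒∃[o]m+o≡n (3*-cancel-≤ {suc a} {q} d
                      (trans (even-reassoc₁ a d) (trans (cong suc eq) (3*-suc q)))) =
    m+1+n≢m _ (trans (even-slack₁ k a e ρ) bal)
  absurd q a (suc (suc b)) ρ d eq bal no-twos = contradiction (no-twos ρ≡0) (λ ())
    where
    ρ≡0 : ρ ≡ 0
    ρ≡0 = m+n≡0⇒m≡0 ρ (m+n≡m⇒n≡0 (trans (even-slack₂ k q a b ρ d)
      (cong₂ (λ x y → 3 * x + 2 * (3 + k) * y) bal eq)))

odd-reassoc₀ : ∀ a d → 1 + (3 * (1 + a) + d) ≡ 3 + (1 + (3 * a + 2 * 0) + d)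
odd-reassoc₀ = solve-∀

odd-slack₀ : ∀ k q a e →
  (3 + k) * (2 * a) + 2 * (q + 1) + (1 + (3 + 2 * k + 2 * (e * (3 + k))))
  ≡ 2 * q + 0 + 2 * ((1 + a + e) * (3 + k))
odd-slack₀ = solve-∀

-- The analogous combination, with 6 times the size equation. The slack contains `2 * k`, so
-- counting alone leaves only n = 2 open.
odd-slack : ∀ k q c a b ρ d →
  2 * (3 + k) * (3 * c) + 3 * (b + (3 + k) * (b + 2 * a)) + 6 * (q + 1)
    + (ρ + (2 * ρ + 2 * (3 + k) * d + k * b + 2 * k))
  ≡ 2 * (3 + k) * (1 + (3 * a + 2 * b) + d) + 3 * (2 * q + ρ) + 6 * (c * (3 + k))
odd-slack = solve-∀

odd-bound : ∀ k q c {w} → q + 1 ≡ c * (3 + k) → Discharged (2 + k) q w → 3 * c ≤ w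
odd-bound k q c size D = ≤-trans (≮⇒≥ λ lt →
    let d , eq = m≤n⇒∃[o]m+o≡n lt in absurd threes twos excess d eq balance no-twos) weight≥
  where
  open Discharged D
  residue : ∀ c a b ρ d → q + 1 ≡ c * (3 + k) → suc (3 * a + 2 * b) + d ≡ 3 * c →
    2 * q + ρ ≡ b + (3 + k) * (b + 2 * a) → ρ ≡ 0 → b ≢ 0
  -- Without twos, weight below 3c means at most c - 1 threes, whose charge falls short of 2q.
  residue c a zero zero d size eq bal refl refl
    with e , refl ← m≤n⇒∃[o]m+o≡n (3*-cancel-≤ {suc a} {c} d
                      (trans (odd-reassoc₀ a d) (trans (cong (3 +_) eq) (sym (*-suc 3 c))))) =
    m+1+n≢m _ (trans (odd-slack₀ k q a e) (cong₂ (λ x y → x + 2 * y) bal (sym size)))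
  absurd : ∀ a b ρ d → suc (3 * a + 2 * b) + d ≡ 3 * c →
    2 * q + ρ ≡ b + (3 + k) * (b + 2 * a) → ¬ (ρ ≡ 0 → b ≡ 0)
  absurd a b ρ d eq bal no-twos = residue c a b ρ d size eq bal ρ≡0 (no-twos ρ≡0)
    where
    ρ≡0 : ρ ≡ 0
    ρ≡0 = m+n≡0⇒m≡0 ρ (m+n≡m⇒n≡0 (trans (odd-slack k q c a b ρ d)
      (cong₂ _+_ (cong₂ (λ x y → 2 * (3 + k) * x + 3 * y) eq bal) (cong (6 *_) (sym size)))))

-- Perfect codes

even : ℕ → Bool
even zero    = true
even (suc t) = not (even t)

even-0ℙ : ∀ t → parity t ≡ 0ℙ → even t ≡ true
even-0ℙ zero          _  = refl
even-0ℙ (suc (suc t)) eq = trans (not-involutive (even t)) (even-0ℙ t eq)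

even-1ℙ : ∀ t → parity t ≡ 1ℙ → even t ≡ false
even-1ℙ (suc zero)    _  = refl
even-1ℙ (suc (suc t)) eq = trans (not-involutive (even t)) (even-1ℙ t eq)

⟦_⟧ : Bool → ℕ
⟦ b ⟧ = if b then 1 else 0

⟦b⟧+⟦not-b⟧ : ∀ b → ⟦ b ⟧ + ⟦ not b ⟧ ≡ 1
⟦b⟧+⟦not-b⟧ true  = refl
⟦b⟧+⟦not-b⟧ false = refl

-- In state s, code s selects a set of words of length t that dominates every non-extreme vertex
-- exactly once; it contains the extreme vertices
--   all (s = nothing, t even), none (s = nothing, t odd),
--   none (s = just i, t even), only iᵗ (s = just i, t odd),
-- and leaves undominated all of them if s = nothing and t is odd, only iᵗ if s = just i and t is even.
step : Maybe (Fin n) → Fin n → Maybe (Fin n)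
step nothing  j = just j
step (just i) j = if does (i ≟ j) then nothing else just i

code : Maybe (Fin n) → Vec (Fin n) m → Bool
code s []      = is-nothing s
code s (j ∷ v) = code (step s j) v

χ : Maybe (Fin n) → Vec (Fin n) m → ℕ
χ s v = ⟦ code s v ⟧

step-same : ∀ (i : Fin n) → step (just i) i ≡ nothing
step-same i rewrite dec-true (i ≟ i) refl = refl

step-other : ∀ {i j : Fin n} → i ≢ j → step (just i) j ≡ just i
step-other {i = i} {j} i≢j rewrite dec-false (i ≟ j) i≢j = refl

-- Reading `k` repeatedly alternates the state between `nothing` and `just k`, hence the mutual
-- induction.
code-nothing : ∀ m (k : Fin n) → code nothing (replicate m k) ≡ even m
code-same    : ∀ m (k : Fin n) → code (just k) (replicate m k) ≡ not (even m)
code-nothing zero    k = refl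
code-nothing (suc m) k = code-same m k
code-same zero    k = refl
code-same (suc m) k rewrite step-same k = trans (code-nothing m k) (sym (not-involutive (even m)))

code-other : ∀ m {i k : Fin n} → i ≢ k → code (just i) (replicate m k) ≡ false
code-other zero    i≢k = refl
code-other (suc m) i≢k rewrite step-other i≢k = code-other m i≢k

clique-length-1 : ∀ (i k : Fin n) → clique (χ (just i)) (k ∷ []) ≡ 1
clique-length-1 {n} i k =
  trans (∑-cong (allFin n) at) (∑-𝟙 _≟_ (Unique.allFin⁺ n) (∈-allFin i))
  where
  at : ∀ l → ⟦ is-nothing (step (just i) l) ⟧ ≡ 𝟙 (i ≟ l)
  at l with does (i ≟ l)
  ... | true  = refl
  ... | false = refl

-- A clique contains a codeword exactly when its common prefix ends in a state `just j`, and then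
-- only the last letter `j` is accepted.
clique-nothing : ∀ m (k : Fin n) → clique (χ nothing) (replicate (suc m) k) ≡ ⟦ even (suc m) ⟧
clique-same    : ∀ m (k : Fin n) → clique (χ (just k)) (replicate (suc m) k) ≡ ⟦ even m ⟧
clique-nothing {n} zero k = trans (∑-const 0 (allFin n)) (*-zeroʳ (length (allFin n)))
clique-nothing (suc m)  k = trans (clique-same m k) (cong ⟦_⟧ (sym (not-involutive (even m))))
clique-same zero    k = clique-length-1 k k
clique-same (suc m) k rewrite step-same k = clique-nothing m k

clique-other : ∀ m {i k : Fin n} → i ≢ k → clique (χ (just i)) (replicate (suc m) k) ≡ 1
clique-other zero    {i} {k} i≢k = clique-length-1 i k
clique-other (suc m) i≢k rewrite step-other i≢k = clique-other m i≢k

-- If `s` is `just i` with `i` equal to `j` or `k`, the copy of `i` starts in `nothing` and the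
-- other copy in `just i`, so the clique and link terms depend on complementary parities. Otherwise
-- the clique supplies the codeword.
coverage-link : ∀ m s {j k : Fin n} → j ≢ k →
  clique (χ (step s j)) (replicate (suc m) k) + χ (step s k) (replicate (suc m) j) ≡ 1
coverage-link m nothing {j} {k} j≢k =
  cong₂ _+_ (clique-other m j≢k) (cong ⟦_⟧ (code-other (suc m) (j≢k ∘ sym)))
coverage-link m (just i) {j} {k} j≢k = by-cases (i ≟ j) (i ≟ k)
  where
  by-cases : Dec (i ≡ j) → Dec (i ≡ k) →
    clique (χ (step (just i) j)) (replicate (suc m) k) + χ (step (just i) k) (replicate (suc m) j) ≡ 1
  by-cases (yes refl) _ rewrite step-same i | step-other j≢k =
    trans (cong₂ _+_ (clique-nothing m k) (cong ⟦_⟧ (code-same (suc m) i))) (⟦b⟧+⟦not-b⟧ (even (suc m)))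
  by-cases (no i≢j) (yes refl) rewrite step-same i | step-other i≢j =
    trans (cong₂ _+_ (clique-same m i) (cong ⟦_⟧ (code-nothing (suc m) j))) (⟦b⟧+⟦not-b⟧ (even m))
  by-cases (no i≢j) (no i≢k) rewrite step-other i≢j | step-other i≢k =
    cong₂ _+_ (clique-other m i≢k) (cong ⟦_⟧ (code-other (suc m) i≢j))

-- Leading letters only advance the state, until what remains is a letter followed by a constant
-- word, the endpoint of a link.
coverage-inner : ∀ s (u : Vec (Fin n) (suc m)) → ¬ IsConst u → coverage (χ s) u ≡ 1
coverage-inner s (i ∷ []) ¬const = contradiction (i , refl) ¬const
coverage-inner {m = suc m} s (i ∷ v@(_ ∷ _)) ¬const with isConst? v
... | yes (k , refl) = coverage-link m s (λ { refl → ¬const (i , refl) })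
... | no  ¬const′    = coverage-inner (step s i) v ¬const′

-- The extreme vertex is its own partner: as a codeword it counts twice, and otherwise its clique
-- has no codeword at all.
coverage-same : ∀ m (i : Fin n) → coverage (χ (just i)) (replicate (suc m) i) ≡ ⟦ even m ⟧ + ⟦ even m ⟧
coverage-same m i rewrite partner-replicate m i = cong₂ _+_ (clique-same m i)
  (cong ⟦_⟧ (trans (code-same (suc m) i) (not-involutive (even m))))

coverage-other : ∀ (i : Fin n) (u : Vec (Fin n) (suc m)) → replicate (suc m) i ≢ u →
  coverage (χ (just i)) u ≡ 1
coverage-other {m = m} i u ≢u with isConst? u
... | no ¬const      = coverage-inner (just i) u ¬const
... | yes (k , refl) = trans
        (cong (λ w → clique (χ (just i)) (replicate (suc m) k) + χ (just i) w) (partner-replicate m k))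
        (cong₂ _+_ (clique-other m i≢k) (cong ⟦_⟧ (code-other (suc m) i≢k)))
  where
  i≢k : i ≢ k
  i≢k refl = ≢u refl

covered⇒dominated : ∀ (c : Vec (Fin n) (suc m) → Bool) {u} → 0 < coverage (⟦_⟧ ∘ c) u →
  c u ≡ true ⊎ (∃[ v ] SierpińskiAdj u v × c v ≡ true)
covered⇒dominated {n} c {u} cov>0 with c (partner u) in eq
... | true with ≡-dec _≟_ (partner u) u
...   | yes p≡u = inj₁ (trans (cong c (sym p≡u)) eq)
...   | no  p≢u = inj₂ (partner u , adj-partner u p≢u , eq)
covered⇒dominated {n} c {u} cov>0 | false
  with k , k>0 ← ∑>0⇒∃ (λ k → ⟦ c (u [last]≔ k) ⟧) (allFin n) (subst (0 <_) (+-identityʳ _) cov>0)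
  with c (u [last]≔ k) in eq′ | ≡-dec _≟_ (u [last]≔ k) u
... | true | yes k≡u = inj₁ (trans (cong c (sym k≡u)) eq′)
... | true | no  k≢u = inj₂ (u [last]≔ k , adj-[last]≔ u k k≢u , eq′)

-- Dominating functions of minimum weight

module Construction {n m : ℕ} (i : Fin n) where

  private
    W = words n (suc m)
    z = replicate (suc m) i
    size = ∑ W (χ (just i))

    δ : Vec (Fin n) (suc m) → ℕ
    δ u = 𝟙 (≡-dec _≟_ z u)

    ∑-δ : ∑ W δ ≡ 1
    ∑-δ = ∑-𝟙 (≡-dec _≟_) (words-unique n (suc m)) (words-complete n z)

  coverage-odd : even m ≡ true → ∀ u → coverage (χ (just i)) u ≡ 1 + δ u
  coverage-odd ev u with ≡-dec _≟_ z u
  ... | yes refl = trans (coverage-same m i) (cong (λ b → ⟦ b ⟧ + ⟦ b ⟧) ev)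
  ... | no  z≢u  = coverage-other i u z≢u

  coverage-even : even m ≡ false → ∀ u → coverage (χ (just i)) u + δ u ≡ 1
  coverage-even ev u with ≡-dec _≟_ z u
  ... | yes refl = cong (_+ 1) (trans (coverage-same m i) (cong (λ b → ⟦ b ⟧ + ⟦ b ⟧) ev))
  ... | no  z≢u  = cong (_+ 0) (coverage-other i u z≢u)

  -- Each codeword is counted n + 1 times, while every word is covered once and `z` twice. Thus the
  -- code itself proves the divisibility.
  size-odd : even m ≡ true → n ^ suc m + 1 ≡ size * suc n
  size-odd ev = begin
    n ^ suc m + 1                 ≡⟨ cong₂ _+_ (*-identityʳ (n ^ suc m)) ∑-δ ⟨
    n ^ suc m * 1 + ∑ W δ         ≡⟨ cong (_+ ∑ W δ) (∑-words-const n (suc m) 1) ⟨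
    ∑ W (λ _ → 1) + ∑ W δ         ≡⟨ ∑-+ (λ _ → 1) δ W ⟨
    ∑ W (λ u → 1 + δ u)           ≡⟨ ∑-cong W (coverage-odd ev) ⟨
    ∑ W (coverage (χ (just i)))   ≡⟨ ∑-coverage n m (χ (just i)) ⟩
    suc n * size                  ≡⟨ *-comm (suc n) size ⟩
    size * suc n                  ∎
    where open ≡-Reasoning

  size-even : even m ≡ false → n ^ suc m ≡ 1 + size * suc n
  size-even ev = begin
    n ^ suc m                                ≡⟨ *-identityʳ (n ^ suc m) ⟨
    n ^ suc m * 1                            ≡⟨ ∑-words-const n (suc m) 1 ⟨
    ∑ W (λ _ → 1)                            ≡⟨ ∑-cong W (coverage-even ev) ⟨
    ∑ W (λ u → coverage (χ (just i)) u + δ u) ≡⟨ ∑-+ (coverage (χ (just i))) δ W ⟩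
    ∑ W (coverage (χ (just i))) + ∑ W δ      ≡⟨ cong₂ _+_ (∑-coverage n m (χ (just i))) ∑-δ ⟩
    suc n * size + 1                         ≡⟨ +-comm (suc n * size) 1 ⟩
    1 + suc n * size                         ≡⟨ cong suc (*-comm (suc n) size) ⟩
    1 + size * suc n                         ∎
    where open ≡-Reasoning

  assign : (Vec (Fin n) (suc m) → Fin 4) → Vec (Fin n) (suc m) → Fin 4
  assign rest u = if code (just i) u then suc (suc (suc zero)) else rest u

  assign-code : ∀ rest v → code (just i) v ≡ true → toℕ (assign rest v) ≡ 3
  assign-code rest v eq rewrite eq = refl

  -- A vertex of value below 2 is no codeword, so the codeword that covers it is a neighbour of
  -- value 3, which serves both conditions.
  assign-dominating : ∀ rest → (∀ u → toℕ (assign rest u) < 2 → 0 < coverage (χ (just i)) u) →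
    IsDoubleRomanDominating (Sierpiński n (suc m)) (assign rest)
  assign-dominating rest covered = record
    { dominates₀ = λ u fu → inj₁ (three-neighbour u (subst (_< 2) (sym fu) z<s))
    ; dominates₁ = λ u fu →
        let v , uv , fv = three-neighbour u (subst (_< 2) (sym fu) ≤-refl)
        in v , uv , ≤-reflexive (sym fv)
    }
    where
    three-neighbour : ∀ u → toℕ (assign rest u) < 2 →
      ∃[ v ] SierpińskiAdj u v × toℕ (assign rest v) ≡ 3
    three-neighbour u fu<2 with covered⇒dominated (code (just i)) (covered u fu<2)
    ... | inj₂ (v , uv , cv) = v , uv , assign-code rest v cv
    ... | inj₁ cu with s≤s (s≤s ()) ← subst (_< 2) (assign-code rest u cu) fu<2

  none lone : Vec (Fin n) (suc m) → Fin 4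
  none _ = zero
  lone u = if does (≡-dec _≟_ z u) then suc (suc zero) else zero

  weight-none : weight (Sierpiński n (suc m)) (assign none) ≡ 3 * size
  weight-none = trans (∑-cong W value) (∑-* 3 (χ (just i)) W)
    where
    value : ∀ u → toℕ (assign none u) ≡ 3 * χ (just i) u
    value u with code (just i) u
    ... | true  = refl
    ... | false = refl

  weight-lone : even m ≡ false → weight (Sierpiński n (suc m)) (assign lone) ≡ 3 * size + 2
  weight-lone ev = begin
    ∑ W (toℕ ∘ assign lone)                         ≡⟨ ∑-cong W value ⟩
    ∑ W (λ u → 3 * χ (just i) u + 2 * δ u)          ≡⟨ ∑-+ _ _ W ⟩
    ∑ W (λ u → 3 * χ (just i) u) + ∑ W (λ u → 2 * δ u)
      ≡⟨ cong₂ _+_ (∑-* 3 (χ (just i)) W) (trans (∑-* 2 δ W) (cong (2 *_) ∑-δ)) ⟩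
    3 * size + 2                                    ∎
    where
    open ≡-Reasoning
    value : ∀ u → toℕ (assign lone u) ≡ 3 * χ (just i) u + 2 * δ u
    value u with ≡-dec _≟_ z u
    -- For even length `z` is not a codeword, so `assign` falls through to the value 2.
    ... | yes refl rewrite trans (code-same (suc m) i) (trans (not-involutive (even m)) ev) = refl
    ... | no  _ with code (just i) u
    ...   | true  = refl
    ...   | false = refl

  none-dominating : even m ≡ true → IsDoubleRomanDominating (Sierpiński n (suc m)) (assign none)
  none-dominating ev = assign-dominating none (λ u _ → subst (0 <_) (sym (coverage-odd ev u)) z<s)

  lone-dominating : even m ≡ false → IsDoubleRomanDominating (Sierpiński n (suc m)) (assign lone)
  lone-dominating ev = assign-dominating lone covered
    where
    covered : ∀ u → toℕ (assign lone u) < 2 → 0 < coverage (χ (just i)) u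
    covered u fu<2 with ≡-dec _≟_ z u | coverage-even ev u
    ... | no  _ | eq = subst (0 <_) (sym (trans (sym (+-identityʳ _)) eq)) z<s
    ... | yes refl | _ with code (just i) u
    ...   | true  with s≤s (s≤s ()) ← fu<2
    ...   | false with s≤s (s≤s ()) ← fu<2

-- The ceiling and the two parities

⌈÷⌉-suc : ∀ q r n → r < n → ⌈ suc r + q * suc n ÷ suc n ⌉ ≡ suc q
-- The ceiling unfolds to integer division of the negated numerator, which branches on this
-- remainder.
⌈÷⌉-suc q r n r<n with (suc r + q * suc n) % suc n in eq
... | zero  = contradiction (trans (sym eq) (trans ([m+kn]%n≡m%n (suc r) q (suc n)) (m<n⇒m%n≡m (s<s r<n)))) (λ ())
... | suc _ = cong suc (trans (+-identityʳ _) (begin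
    (suc r + q * suc n) / suc n              ≡⟨ +-distrib-/ (suc r) (q * suc n) remainders ⟩
    suc r / suc n + q * suc n / suc n        ≡⟨ cong₂ _+_ (m<n⇒m/n≡0 (s<s r<n)) (m*n/n≡m q (suc n)) ⟩
    q                                        ∎))
  where
  open ≡-Reasoning
  remainders : suc r % suc n + q * suc n % suc n < suc n
  remainders = subst (_< suc n)
    (sym (trans (cong (suc r % suc n +_) (m*n%n≡0 q (suc n))) (+-identityʳ _))) (m%n<n (suc r) (suc n))

theorem3p3 : (n t : ℕ) → 2 ≤ n → 1 ≤ t →
    (parity t ≡ 1ℙ → γdR (Sierpiński n t) (3 * ⌈ n ^ t ÷ suc n ⌉)) ×
    (parity t ≡ 0ℙ → γdR (Sierpiński n t) (3 * ⌈ n ^ t ÷ suc n ⌉ ∸ 1))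
theorem3p3 1 t (s≤s ()) _
theorem3p3 n@(suc (suc k)) t@(suc m) _ _ = odd , evn
  where
  open Construction {n} {m} zero
  a = ∑ (words n t) (χ (just (zero {suc k})))

  odd : parity t ≡ 1ℙ → γdR (Sierpiński n t) (3 * ⌈ n ^ t ÷ suc n ⌉)
  odd eq = subst (γdR (Sierpiński n t) ∘ (3 *_)) (sym (ceiling a size)) record
    { attained = assign none , none-dominating ev , weight-none
    ; minimal  = λ f dom → odd-bound k (n ^ t) a size (discharge n m f dom)
    }
    where
    ev : even m ≡ true
    ev = not-injective (even-1ℙ t eq)
    size : n ^ t + 1 ≡ a * suc n
    size = size-odd ev
    -- For c > 0 this reads n^t = n + (c - 1)(n + 1), with remainder n, so `⌈÷⌉-suc` applies with r
    -- = n - 1.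
    ceiling : ∀ c → n ^ t + 1 ≡ c * suc n → ⌈ n ^ t ÷ suc n ⌉ ≡ c
    ceiling zero    eq = contradiction (trans (+-comm 1 (n ^ t)) eq) λ ()
    ceiling (suc c) eq = trans
      (cong (λ N → ⌈ N ÷ suc n ⌉) (suc-injective (trans (+-comm 1 (n ^ t)) eq)))
      (⌈÷⌉-suc c (suc k) n ≤-refl)

  evn : parity t ≡ 0ℙ → γdR (Sierpiński n t) (3 * ⌈ n ^ t ÷ suc n ⌉ ∸ 1)
  evn eq = subst (γdR (Sierpiński n t)) (sym target) record
    { attained = assign lone , lone-dominating ev , weight-lone ev
    ; minimal  = λ f dom →
        even-bound k a (subst (λ N → Discharged n N (weight (Sierpiński n t) f)) size (discharge n m f dom))
    }
    where
    ev : even m ≡ false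
    ev = not-injective (even-0ℙ t eq)
    size : n ^ t ≡ 1 + a * suc n
    size = size-even ev
    target : 3 * ⌈ n ^ t ÷ suc n ⌉ ∸ 1 ≡ 3 * a + 2
    target = begin
      3 * ⌈ n ^ t ÷ suc n ⌉ ∸ 1            ≡⟨ cong (λ N → 3 * ⌈ N ÷ suc n ⌉ ∸ 1) size ⟩
      3 * ⌈ 1 + a * suc n ÷ suc n ⌉ ∸ 1    ≡⟨ cong (λ c → 3 * c ∸ 1) (⌈÷⌉-suc a 0 n z<s) ⟩
      3 * suc a ∸ 1                        ≡⟨ cong (_∸ 1) (3*-suc a) ⟨
      3 * a + 2                            ∎
      where open ≡-Reasoning
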